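{- Consider a rooted search tree in which every internal node has exactly $b\ge 1$ children and every leaf is at depth $d$. For each internal node $S$ and each action $A$ available at $S$, let $P_{\textrm{best}}(A\mid S)\in[0,1]$ with $\sum_{A} P_{\textrm{best}}(A\mid S)=1$ over the $b$ actions at $S$; these values become known only when $S$ is explored. Let $P_{\textrm{uni}}=1/b$. Given a set $\mathcal{E}$ of explored internal nodes, define for each leaf $\hat S$ with root-to-leaf path $S_0\xrightarrow{A_0}S_1\xrightarrow{A_1}\cdots\xrightarrow{A_{d-1}}S_d=\hat S$ $$P_{\textrm{opt}}(\hat S)=\prod_{k:\,S_k\in\mathcal{E}} P_{\textrm{best}}(A_k\mid S_k)\cdot\prod_{k:\,S_k\notin\mathcal{E},\,0\le k\le d-1} P_{\textrm{uni}} .$$ Suppose initially no node is explored, and run the greedy procedure: starting at the root, explore the current state $S$ and move along an action $A$ maximizing $P_{\textrm{best}}(A\mid S)$, repeating until a leaf is reached. Then the greedy procedure explores at most $d$ nodes, and the leaf it reaches maximizes $P_{\textrm{opt}}(\hat S)$ over all leaves $\hat S$, where $P_{\textrm{opt}}$ is computed with $\mathcal{E}$ equal to the set of nodes explored by the greedy procedure.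
   Context: A search problem is modelled as a tree whose nodes are states and edges are actions; each root-to-leaf path (leaf) is a candidate solution. $P_{\textrm{best}}(A\mid S)$ is the probability that the optimal candidate solution in the subtree rooted at $S$ lies in the subtree reached by taking action $A$ from $S$. The standing modelling assumptions are: in unexplored parts of the tree the action probabilities are taken to be uniform, equal to $P_{\textrm{uni}}=1/b$; the depth $d$ of the tree is uniform and known; the branching factor $b$ is constant and known. $P_{\textrm{opt}}(\hat S)$ is the (estimated) probability that candidate solution $\hat S$ is the optimal one. -}

module Defs where

open import Level using (Level; _⊔_) renaming (suc to lsuc)
open import Algebra.Bundles using (CommutativeRing)
open import Data.Nat.Base as ℕ using (ℕ)
import Data.Nat.Properties as ℕ
open import Data.Fin.Base using (Fin; toℕ)
import Data.Fin.Properties as Fin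
open import Data.Vec.Base using (Vec; []; _∷ʳ_; lookup; truncate)
import Data.Vec.Properties as Vec
open import Data.List.Base using (List; []; _∷_; map; filter; foldr; allFin)
import Data.List.Membership.DecPropositional as DecMembership
open import Relation.Binary.Core using (Rel)
open import Relation.Binary.Definitions using (DecidableEquality)
open import Relation.Binary.Structures using (IsTotalOrder)
open import Relation.Binary.PropositionalEquality using (refl)
open import Relation.Nullary using (¬_; yes; no; ¬?)
import Algebra.Definitions.RawMonoid as RawMonoidDefs

-- Totally ordered fields, standing in for ℝ. The inverse is a total
-- operation whose value at 0# is unconstrained.
record OrderedField (c ℓ₁ ℓ₂ : Level) : Set (lsuc (c ⊔ ℓ₁ ⊔ ℓ₂)) where
  infix 4 _≤_
  infix 9 _⁻¹
  field
    commutativeRing : CommutativeRing c ℓ₁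
  open CommutativeRing commutativeRing public
  field
    _⁻¹          : Carrier → Carrier
    ⁻¹-cong      : ∀ {x y} → x ≈ y → x ⁻¹ ≈ y ⁻¹
    ⁻¹-inverseʳ  : ∀ x → ¬ (x ≈ 0#) → x * x ⁻¹ ≈ 1#
    0≉1          : ¬ (0# ≈ 1#)
    _≤_          : Rel Carrier ℓ₂
    isTotalOrder : IsTotalOrder _≈_ _≤_
    +-monoˡ-≤    : ∀ {x y} z → x ≤ y → x + z ≤ y + z
    *-nonNeg     : ∀ {x y} → 0# ≤ x → 0# ≤ y → 0# ≤ x * y

  open RawMonoidDefs +-rawMonoid public using (sum) renaming (_×_ to _·_)

  product : List Carrier → Carrier
  product = foldr _*_ 1#

-- In the complete b-ary tree of depth d the nodes at depth k are the words of
-- k actions leading to them from the root: the root is [] and taking action A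
-- at S leads to S ∷ʳ A.
Node : ℕ → ℕ → Set
Node b k = Vec (Fin b) k

Leaf : ℕ → ℕ → Set
Leaf b d = Node b d

record Internal (b d : ℕ) : Set where
  constructor internal
  field
    {depth}  : ℕ
    node     : Node b depth
    .depth<d : depth ℕ.< d

infix 4 _≟_

_≟_ : ∀ {b d} → DecidableEquality (Internal b d)
internal {k} v _ ≟ internal {l} w _ with k ℕ.≟ l
... | no k≢l = no λ { refl → k≢l refl }
... | yes refl with Vec.≡-dec Fin._≟_ v w
...   | yes refl = yes refl
...   | no v≢w   = no λ { refl → v≢w refl }

-- The state S_k and the action A_k (0 ≤ k < d) on the path to a leaf.
stateAt : ∀ {b d} → Leaf b d → Fin d → Internal b d
stateAt L k = internal (truncate (Fin.toℕ≤n k) L) (Fin.toℕ<n k)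

actionAt : ∀ {b d} → Leaf b d → Fin d → Fin b
actionAt = lookup

module Search {c ℓ₁ ℓ₂} (F : OrderedField c ℓ₁ ℓ₂) {b d : ℕ}
              (P-best : Internal b d → Fin b → OrderedField.Carrier F) where

  open OrderedField F
  open DecMembership (_≟_ {b} {d}) using (_∈?_)

  P-uni : Carrier
  P-uni = (b · 1#) ⁻¹

  -- The tree is finite, so a set of internal nodes is given by a list;
  -- only membership in it matters here.
  P-opt : List (Internal b d) → Leaf b d → Carrier
  P-opt E L =
      product (map (λ k → P-best (stateAt L k) (actionAt L k))
                   (filter (λ k → stateAt L k ∈? E) (allFin d)))
    * product (map (λ _ → P-uni)
                   (filter (λ k → ¬? (stateAt L k ∈? E)) (allFin d)))

  IsBestAction : Internal b d → Fin b → Set ℓ₂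
  IsBestAction S A = ∀ A′ → P-best S A′ ≤ P-best S A

  -- Greedy S E: some run of the greedy procedure, with ties between best
  -- actions broken arbitrarily, gets to the current state S having explored
  -- the nodes E (most recent first). It has stopped when S is a leaf.
  data Greedy : {k : ℕ} → Node b k → List (Internal b d) → Set ℓ₂ where
    start : Greedy [] []
    step  : ∀ {k} {S : Node b k} {E} → Greedy S E →
            (k<d : k ℕ.< d) (A : Fin b) → IsBestAction (internal S k<d) A →
            Greedy (S ∷ʳ A) (internal S k<d ∷ E)

{-# OPTIONS --safe #-}

-- P-opt is a product of d nonnegative weights, one per depth. On the greedy
-- path every state is explored and its weight is a maximum of P-best, which is
-- at least the average P-uni. Any other leaf has, at each depth, either an
-- unexplored state, of weight P-uni, or an explored one, which is then the
-- greedy state of that depth and contributes at most the greedy maximum. So the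
-- greedy leaf dominates factor by factor.
module Submission where

open import Defs
open import Data.Nat.Base as ℕ using (ℕ; zero; suc; z≤n; s≤s)
import Data.Nat.Properties as ℕ
open import Data.Fin.Base using (Fin; zero; suc; fromℕ<)
import Data.Fin.Properties as Fin
open import Data.Vec.Base using (Vec; []; _∷_; _∷ʳ_; lookup; truncate)
open import Data.List.Base using (List; []; _∷_; length; map; filter; allFin)
open import Data.List.Membership.Propositional using (_∈_)
open import Data.List.Membership.Propositional.Properties using (∈-allFin)
import Data.List.Membership.DecPropositional as DecMembership
open import Data.List.Relation.Unary.Any using (here; there)
import Data.List.Relation.Unary.All as All
import Data.List.Extrema as Extrema
open import Data.Product.Base using (_×_; ∃; ∃₂; _,_; proj₁; proj₂)
open import Data.Sum.Base using (inj₁; inj₂)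
open import Data.Bool.Base using (if_then_else_)
open import Relation.Binary.Bundles using (TotalOrder)
open import Relation.Binary.Structures using (IsTotalOrder)
open import Relation.Binary.PropositionalEquality as ≡ using (_≡_; refl)
open import Relation.Nullary using (¬_; yes; no; does; ¬?; contradiction)
open import Relation.Unary using (Decidable)
import Algebra.Properties.CommutativeSemigroup as CommutativeSemigroupProperties
import Algebra.Properties.Ring as RingProperties
import Relation.Binary.Reasoning.PartialOrder as ≤-Reasoning

-- Prefixes and entries of a vector extended at its end.

module _ {a} {A : Set a} where

  -- Paths grow at the end, whereas `truncate` and `lookup` recurse from the front, so this fact and
  -- its companions go by induction on the vector or on the position.
  truncate-∷ʳ : ∀ {m n} (m≤n : m ℕ.≤ n) (m≤1+n : m ℕ.≤ suc n) (xs : Vec A n) x →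
                truncate m≤1+n (xs ∷ʳ x) ≡ truncate m≤n xs
  truncate-∷ʳ z≤n       m≤1+n       xs       x = refl
  truncate-∷ʳ (s≤s m≤n) (s≤s m≤1+n) (y ∷ xs) x = ≡.cong (y ∷_) (truncate-∷ʳ m≤n m≤1+n xs x)

  truncate-init : ∀ {n} (n≤1+n : n ℕ.≤ suc n) (xs : Vec A n) x → truncate n≤1+n (xs ∷ʳ x) ≡ xs
  truncate-init n≤1+n       []       x = refl
  truncate-init (s≤s n≤1+n) (y ∷ xs) x = ≡.cong (y ∷_) (truncate-init n≤1+n xs x)

  lookup-∷ʳ-init : ∀ {m n} .(m<n : m ℕ.< n) .(m<1+n : m ℕ.< suc n) (xs : Vec A n) x →
                   lookup (xs ∷ʳ x) (fromℕ< m<1+n) ≡ lookup xs (fromℕ< m<n)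
  lookup-∷ʳ-init {zero}  m<n m<1+n (y ∷ xs) x = refl
  lookup-∷ʳ-init {suc m} m<n m<1+n (y ∷ xs) x =
    lookup-∷ʳ-init (ℕ.s<s⁻¹ m<n) (ℕ.s<s⁻¹ m<1+n) xs x

  lookup-∷ʳ-last : ∀ {n} .(n<1+n : n ℕ.< suc n) (xs : Vec A n) x →
                   lookup (xs ∷ʳ x) (fromℕ< n<1+n) ≡ x
  lookup-∷ʳ-last n<1+n []       x = refl
  lookup-∷ʳ-last n<1+n (y ∷ xs) x = lookup-∷ʳ-last (ℕ.s<s⁻¹ n<1+n) xs x

-- Inequalities in ordered fields.

module OrderedFieldProperties {c ℓ₁ ℓ₂} (F : OrderedField c ℓ₁ ℓ₂) where

  open OrderedField F hiding (refl; zero)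
  open IsTotalOrder isTotalOrder public
    using (total; antisym; ≤-respˡ-≈; ≤-respʳ-≈)
    renaming (refl to ≤-refl; reflexive to ≤-reflexive; trans to ≤-trans)

  totalOrder : TotalOrder c ℓ₁ ℓ₂
  totalOrder = record { isTotalOrder = isTotalOrder }

  open ≤-Reasoning (TotalOrder.poset totalOrder)
  open RingProperties ring
    using (-‿distribˡ-*; -‿distribʳ-*; -‿involutive; [y-z]x≈yx-zx; //-rightDividesˡ)

  +-mono-≤ : ∀ {x y u v} → x ≤ y → u ≤ v → x + u ≤ y + v
  +-mono-≤ {x} {y} {u} {v} x≤y u≤v = begin
    x + u ≤⟨ +-monoˡ-≤ u x≤y ⟩
    y + u ≈⟨ +-comm y u ⟩
    u + y ≤⟨ +-monoˡ-≤ y u≤v ⟩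
    v + y ≈⟨ +-comm v y ⟩
    y + v ∎

  x≤y⇒0≤y-x : ∀ {x y} → x ≤ y → 0# ≤ y - x
  x≤y⇒0≤y-x {x} {y} x≤y = begin
    0#    ≈⟨ -‿inverseʳ x ⟨
    x - x ≤⟨ +-monoˡ-≤ (- x) x≤y ⟩
    y - x ∎

  0≤y-x⇒x≤y : ∀ {x y} → 0# ≤ y - x → x ≤ y
  0≤y-x⇒x≤y {x} {y} 0≤y-x = begin
    x         ≈⟨ +-identityˡ x ⟨
    0# + x    ≤⟨ +-monoˡ-≤ x 0≤y-x ⟩
    y - x + x ≈⟨ //-rightDividesˡ x y ⟩
    y         ∎

  *-monoˡ-≤ : ∀ {x y z} → 0# ≤ z → x ≤ y → x * z ≤ y * z
  *-monoˡ-≤ {x} {y} {z} 0≤z x≤y =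
    0≤y-x⇒x≤y (≤-respʳ-≈ ([y-z]x≈yx-zx z y x) (*-nonNeg (x≤y⇒0≤y-x x≤y) 0≤z))

  *-monoʳ-≤ : ∀ {x y z} → 0# ≤ z → x ≤ y → z * x ≤ z * y
  *-monoʳ-≤ 0≤z x≤y = ≤-respˡ-≈ (*-comm _ _) (≤-respʳ-≈ (*-comm _ _) (*-monoˡ-≤ 0≤z x≤y))

  0≤x*x : ∀ x → 0# ≤ x * x
  0≤x*x x with total 0# x
  ... | inj₁ 0≤x = *-nonNeg 0≤x 0≤x
  ... | inj₂ x≤0 = begin
    0#            ≤⟨ *-nonNeg 0≤-x 0≤-x ⟩
    - x * - x     ≈⟨ -‿distribˡ-* x (- x) ⟨
    - (x * - x)   ≈⟨ -‿cong (-‿distribʳ-* x x) ⟨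
    - (- (x * x)) ≈⟨ -‿involutive (x * x) ⟩
    x * x         ∎
    where
    0≤-x : 0# ≤ - x
    0≤-x = ≤-respʳ-≈ (+-identityˡ (- x)) (x≤y⇒0≤y-x x≤0)

  0≤1 : 0# ≤ 1#
  0≤1 = ≤-respʳ-≈ (*-identityˡ 1#) (0≤x*x 1#)

  0≤n·1 : ∀ n → 0# ≤ n · 1#
  0≤n·1 zero    = ≤-refl
  0≤n·1 (suc n) = ≤-respˡ-≈ (+-identityˡ 0#) (+-mono-≤ 0≤1 (0≤n·1 n))

  -- If the sum vanished, then `1# ≤ 0#`, and antisymmetry with `0≤1` would collapse the field.
  n·1≉0 : ∀ {n} → 1 ℕ.≤ n → ¬ (n · 1# ≈ 0#)
  n·1≉0 {suc n} _ n·1≈0 = 0≉1 (antisym 0≤1 (begin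
    1#          ≈⟨ +-identityʳ 1# ⟨
    1# + 0#     ≤⟨ +-mono-≤ ≤-refl (0≤n·1 n) ⟩
    1# + n · 1# ≈⟨ n·1≈0 ⟩
    0#          ∎))

  -- The inverse equals its own square times `x`, a product of two nonnegative elements; no case
  -- split on its sign is needed.
  0≤x⇒0≤x⁻¹ : ∀ {x} → ¬ (x ≈ 0#) → 0# ≤ x → 0# ≤ x ⁻¹
  0≤x⇒0≤x⁻¹ {x} x≉0 0≤x = begin
    0#                ≤⟨ *-nonNeg (0≤x*x (x ⁻¹)) 0≤x ⟩
    x ⁻¹ * x ⁻¹ * x   ≈⟨ *-assoc (x ⁻¹) (x ⁻¹) x ⟩
    x ⁻¹ * (x ⁻¹ * x) ≈⟨ *-congˡ (*-comm (x ⁻¹) x) ⟩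
    x ⁻¹ * (x * x ⁻¹) ≈⟨ *-congˡ (⁻¹-inverseʳ x x≉0) ⟩
    x ⁻¹ * 1#         ≈⟨ *-identityʳ (x ⁻¹) ⟩
    x ⁻¹              ∎

  sum-≤ : ∀ {n} {f : Fin n → Carrier} {m} → (∀ i → f i ≤ m) → sum f ≤ n · 1# * m
  sum-≤ {zero}  {f} {m} f≤m = ≤-reflexive (sym (zeroˡ m))
  sum-≤ {suc n} {f} {m} f≤m = begin
    f zero + sum (λ i → f (suc i)) ≤⟨ +-mono-≤ (f≤m zero) (sum-≤ (λ i → f≤m (suc i))) ⟩
    m + n · 1# * m                 ≈⟨ +-congʳ (*-identityˡ m) ⟨
    1# * m + n · 1# * m            ≈⟨ distribʳ m 1# (n · 1#) ⟨
    (1# + n · 1#) * m              ∎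

  -- Multiply `sum f ≤ n · 1# * m` by the nonnegative inverse of `n · 1#`. With `f` the distribution
  -- at a state, this compares `P-uni` with the best action.
  mean≤max : ∀ {n} {f : Fin n → Carrier} {m} → 1 ℕ.≤ n →
             sum f ≈ 1# → (∀ i → f i ≤ m) → (n · 1#) ⁻¹ ≤ m
  mean≤max {n} {f} {m} 1≤n Σf≈1 f≤m = begin
    N ⁻¹           ≈⟨ *-identityʳ (N ⁻¹) ⟨
    N ⁻¹ * 1#      ≈⟨ *-congˡ Σf≈1 ⟨
    N ⁻¹ * sum f   ≤⟨ *-monoʳ-≤ (0≤x⇒0≤x⁻¹ (n·1≉0 1≤n) (0≤n·1 n)) (sum-≤ f≤m) ⟩
    N ⁻¹ * (N * m) ≈⟨ *-assoc (N ⁻¹) N m ⟨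
    N ⁻¹ * N * m   ≈⟨ *-congʳ (*-comm (N ⁻¹) N) ⟩
    N * N ⁻¹ * m   ≈⟨ *-congʳ (⁻¹-inverseʳ N (n·1≉0 1≤n)) ⟩
    1# * m         ≈⟨ *-identityˡ m ⟩
    m              ∎
    where
    N : Carrier
    N = n · 1#

  -- Finite products.

  module _ {a} {A : Set a} where

    product-nonNeg : ∀ {f : A → Carrier} → (∀ x → 0# ≤ f x) → ∀ xs → 0# ≤ product (map f xs)
    product-nonNeg 0≤f []       = 0≤1
    product-nonNeg 0≤f (x ∷ xs) = *-nonNeg (0≤f x) (product-nonNeg 0≤f xs)

    -- Replace the head factor first, then the tail. The second step multiplies by `g x`, which is
    -- nonnegative because it lies above `f x`.
    product-mono-≤ : ∀ {f g : A → Carrier} → (∀ x → 0# ≤ f x) → (∀ x → f x ≤ g x) →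
                     ∀ xs → product (map f xs) ≤ product (map g xs)
    product-mono-≤ 0≤f f≤g []       = ≤-refl
    product-mono-≤ 0≤f f≤g (x ∷ xs) = ≤-trans
      (*-monoˡ-≤ (product-nonNeg 0≤f xs) (f≤g x))
      (*-monoʳ-≤ (≤-trans (0≤f x) (f≤g x)) (product-mono-≤ 0≤f f≤g xs))

    -- Merges the two products in `P-opt` into one over all depths, so that two leaves can be
    -- compared factor by factor.
    product-filter : ∀ {p} {P : A → Set p} (P? : Decidable P) (f g : A → Carrier) xs →
      product (map f (filter P? xs)) * product (map g (filter (λ x → ¬? (P? x)) xs))
      ≈ product (map (λ x → if does (P? x) then f x else g x) xs)
    product-filter P? f g [] = *-identityˡ 1#
    product-filter P? f g (x ∷ xs) with P? x
    ... | yes _ = trans (*-assoc _ _ _) (*-congˡ (product-filter P? f g xs))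
    ... | no  _ = trans (x∙yz≈y∙xz _ _ _) (*-congˡ (product-filter P? f g xs))
      where open CommutativeSemigroupProperties *-commutativeSemigroup using (x∙yz≈y∙xz)

-- Runs of the greedy procedure and the nodes they explore.

module GreedyProperties {c ℓ₁ ℓ₂} (F : OrderedField c ℓ₁ ℓ₂) {b d : ℕ}
                        (P-best : Internal b d → Fin b → OrderedField.Carrier F) where

  open OrderedField F using (Carrier; _≤_; 0#; 1#; sum; _≈_; product; sym)
  open OrderedFieldProperties F
  open Search F P-best
  open DecMembership (_≟_ {b} {d}) using (_∈?_)

  greedy-depth≤d : ∀ {k} {S : Node b k} {E} → Greedy S E → k ℕ.≤ d
  greedy-depth≤d start            = z≤n
  greedy-depth≤d (step _ k<d _ _) = k<d

  length-explored : ∀ {k} {S : Node b k} {E} → Greedy S E → length E ≡ k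
  length-explored start          = refl
  length-explored (step g _ _ _) = ≡.cong suc (length-explored g)

  bestAction : 1 ℕ.≤ b → ∀ S → ∃ (IsBestAction S)
  bestAction 1≤b S = argmax (P-best S) A₀ (allFin b) ,
    λ A → All.lookup (f[xs]≤f[argmax] A₀ (allFin b)) (∈-allFin A)
    where
    open Extrema totalOrder using (argmax; f[xs]≤f[argmax])
    -- `argmax` needs a default element; `1 ≤ b` provides action 0.
    A₀ : Fin b
    A₀ = fromℕ< 1≤b

  greedy-run : 1 ℕ.≤ b → ∀ k → k ℕ.≤ d → ∃₂ λ (S : Node b k) E → Greedy S E
  greedy-run 1≤b zero    _   = [] , [] , start
  greedy-run 1≤b (suc k) k<d =
    let S , E , g = greedy-run 1≤b k (ℕ.<⇒≤ k<d)
        A , best  = bestAction 1≤b (internal S k<d)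
    in S ∷ʳ A , internal S k<d ∷ E , step g k<d A best

  explored-depth : ∀ {k} {S : Node b k} {E T} → Greedy S E → T ∈ E → Internal.depth T ℕ.< k
  explored-depth (step _ _ _ _) (here refl) = ℕ.≤-refl
  explored-depth (step g _ _ _) (there T∈E) = ℕ.m<n⇒m<1+n (explored-depth g T∈E)

  -- The newest explored node is the state just left, and the older ones are prefixes of that state
  -- by induction; a further action changes no prefix.
  explored-on-path : ∀ {k} {S : Node b k} {E T} → Greedy S E → T ∈ E →
                     (T≤k : Internal.depth T ℕ.≤ k) → truncate T≤k S ≡ Internal.node T
  explored-on-path (step {S = S} _ _ A _) (here refl) T≤k = truncate-init T≤k S A
  explored-on-path (step {S = S} g _ A _) (there T∈E) T≤k =
    ≡.trans (truncate-∷ʳ T≤k′ T≤k S A) (explored-on-path g T∈E T≤k′)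
    where T≤k′ = ℕ.<⇒≤ (explored-depth g T∈E)

  -- Converse of `explored-on-path`, together with optimality of the action taken. The bounds are
  -- separate arguments so that the proofs occurring in `stateAt` can be supplied.
  path-explored : ∀ {k} {S : Node b k} {E} → Greedy S E →
                  ∀ {j} (j<k : j ℕ.< k) (j≤k : j ℕ.≤ k) .(j<d : j ℕ.< d) →
                  internal (truncate j≤k S) j<d ∈ E
                  × IsBestAction (internal (truncate j≤k S) j<d) (lookup S (fromℕ< j<k))
  path-explored (step {k = k} {S} g k<d A best) {j} j<1+k j≤1+k j<d
    with ℕ.m≤n⇒m<n∨m≡n (ℕ.s≤s⁻¹ j<1+k)
  -- Depth `k` is that of the last state left, whose action is the newly appended `A`.
  ... | inj₂ refl
    rewrite truncate-init j≤1+k S A | lookup-∷ʳ-last j<1+k S A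
    = here refl , best
  ... | inj₁ j<k
    rewrite truncate-∷ʳ (ℕ.<⇒≤ j<k) j≤1+k S A | lookup-∷ʳ-init j<k j<1+k S A
    = let T∈E , best′ = path-explored g j<k (ℕ.<⇒≤ j<k) j<d in there T∈E , best′

  module _ {L : Leaf b d} {E : List (Internal b d)} (g : Greedy L E) (k : Fin d) where

    state-explored : stateAt L k ∈ E
    state-explored = proj₁ (path-explored g (Fin.toℕ<n k) (Fin.toℕ≤n k) (Fin.toℕ<n k))

    action-best : IsBestAction (stateAt L k) (actionAt L k)
    -- `path-explored` indexes the action by `fromℕ<` of a bound; this is turned back into `k`.
    action-best = ≡.subst (λ i → IsBestAction (stateAt L k) (lookup L i))
      (Fin.fromℕ<-toℕ k (Fin.toℕ<n k))
      (proj₂ (path-explored g (Fin.toℕ<n k) (Fin.toℕ≤n k) (Fin.toℕ<n k)))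

    -- Any explored node of depth `toℕ k` is the prefix of `L` of that length, so a run explores
    -- only one node per depth.
    explored-state-unique : ∀ L′ → stateAt L′ k ∈ E → stateAt L′ k ≡ stateAt L k
    explored-state-unique L′ S′∈E = ≡.cong (λ S → internal S (Fin.toℕ<n k))
      (≡.sym (explored-on-path g S′∈E (Fin.toℕ≤n k)))

  -- Comparison of leaves depth by depth.

  weight : List (Internal b d) → Leaf b d → Fin d → Carrier
  weight E L k =
    if does (stateAt L k ∈? E) then P-best (stateAt L k) (actionAt L k) else P-uni

  P-opt≈product-weight : ∀ E L → P-opt E L ≈ product (map (weight E L) (allFin d))
  P-opt≈product-weight E L = product-filter (λ k → stateAt L k ∈? E)
    (λ k → P-best (stateAt L k) (actionAt L k)) (λ _ → P-uni) (allFin d)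

  module _ (1≤b : 1 ℕ.≤ b) where

    weight-nonNeg : (∀ S A → 0# ≤ P-best S A) → ∀ E L k → 0# ≤ weight E L k
    weight-nonNeg 0≤P-best E L k with stateAt L k ∈? E
    ... | yes _ = 0≤P-best _ _
    -- Here `1 ≤ b` matters: the value of the inverse at `0#` is unconstrained.
    ... | no  _ = 0≤x⇒0≤x⁻¹ (n·1≉0 1≤b) (0≤n·1 b)

    weight-≤-greedy : (∀ S → sum (P-best S) ≈ 1#) → ∀ {L E} → Greedy L E →
                      ∀ L′ k → weight E L′ k ≤ weight E L k
    weight-≤-greedy ΣP≈1 {L} {E} g L′ k with stateAt L k ∈? E | stateAt L′ k ∈? E
    ... | no S∉E | _        = contradiction (state-explored g k) S∉E
    ... | yes _  | no _     = mean≤max 1≤b (ΣP≈1 (stateAt L k)) (action-best g k)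
    -- Both leaves pass through the same state at this depth, so two actions at one node are
    -- compared.
    ... | yes _  | yes S′∈E = ≡.subst
      (λ S → P-best S (actionAt L′ k) ≤ P-best (stateAt L k) (actionAt L k))
      (≡.sym (explored-state-unique g k L′ S′∈E)) (action-best g k (actionAt L′ k))

    greedy-optimal : (∀ S A → 0# ≤ P-best S A) → (∀ S → sum (P-best S) ≈ 1#) →
                     ∀ {L E} → Greedy L E → ∀ L′ → P-opt E L′ ≤ P-opt E L
    greedy-optimal 0≤P-best ΣP≈1 {L} {E} g L′ =
      ≤-respˡ-≈ (sym (P-opt≈product-weight E L′)) (≤-respʳ-≈ (sym (P-opt≈product-weight E L))
        (product-mono-≤ (weight-nonNeg 0≤P-best E L′) (weight-≤-greedy ΣP≈1 g L′) (allFin d)))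

theorem1 : ∀ {c ℓ₁ ℓ₂} (F : OrderedField c ℓ₁ ℓ₂) (b d : ℕ) → 1 ℕ.≤ b →
    let open OrderedField F in
    (P-best : Internal b d → Fin b → Carrier) →
    (∀ S A → 0# ≤ P-best S A × P-best S A ≤ 1#) →
    (∀ S → sum (P-best S) ≈ 1#) →
    let open Search F P-best in
    -- the procedure never explores more than d nodes
    (∀ {k} {S : Node b k} {E : List (Internal b d)} → Greedy S E → length E ℕ.≤ d)
    -- it can be run until a leaf is reached
    × (∃₂ λ (L : Leaf b d) (E : List (Internal b d)) → Greedy L E)
    -- whichever leaf it reaches is optimal
    × (∀ (L : Leaf b d) (E : List (Internal b d)) → Greedy L E → ∀ (L′ : Leaf b d) → P-opt E L′ ≤ P-opt E L)
theorem1 F b d 1≤b P-best P-best∈[0,1] ΣP≈1 =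
    (λ g → ℕ.≤-trans (ℕ.≤-reflexive (length-explored g)) (greedy-depth≤d g))
  , greedy-run 1≤b d ℕ.≤-refl
  , λ L E g → greedy-optimal 1≤b (λ S A → proj₁ (P-best∈[0,1] S A)) ΣP≈1 g
  where open GreedyProperties F P-best
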